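{- Fix nonnegative integers $m,d$. Let $G(x,y,z_{ -d},\dots,z_0,z_1,\dots)=\sum_{P\in\mathcal{A}_{m,d}}x^{\mathrm{size}(P)}y^{\mathrm{pa}(P)}\prod_{i\ge -d}z_i^{\phi_i(P)}$ and $g(x,z_{ -d},\dots)=G(x,1,z_{ -d},\dots)$. Then \[ \frac{1-x}{1-xy}\,g\!\left(\frac{x(1-x)}{1-xy},z_{ -d},z_{ -d+1},\dots\right)=G(x,y,z_{ -d},z_{ -d+1},\dots). \]
   Context: $\mathcal{A}_{m,d}$ is the set of lattice paths of upsteps $U=(1,1)$, downsteps $D=(1,-1)$ and flatsteps $F=(2,0)$ that start at $(0,m)$, end on the $x$-axis, and whose lowest point is at level $-d$. The size of a path is (number of flatsteps) + (number of downsteps); $\phi_i(P)$ is the number of flatsteps at level $i$. An ascent is a maximal subpath of the form $U^k$ ($k\ge1$); a pyramid is a maximal subpath of the form $U^kD^k$ ($k\ge1$); a pyramid ascent is an ascent that is the first half of a pyramid; $\mathrm{pa}(P)$ is the number of pyramid ascents. All series are formal power series. -}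

module Defs where

open import Level using (Level)
open import Data.Bool using (Bool; true; false; _∧_; if_then_else_)
open import Data.Nat as ℕ using (ℕ; zero; suc; _∸_)
open import Data.Integer as ℤ using (ℤ; +_; -_)
open import Data.List using (List; []; _∷_; map; concatMap; foldr; upTo; length)
open import Relation.Nullary.Decidable using (⌊_⌋)
open import Algebra.Bundles using (CommutativeRing)

data Step : Set where
  U D F : Step

δ : Step → ℤ
δ U = + 1
δ D = - (+ 1)
δ F = + 0

endHeight : ℤ → List Step → ℤ
endHeight h []      = h
endHeight h (s ∷ w) = endHeight (h ℤ.+ δ s) w

minHeight : ℤ → List Step → ℤ
minHeight h []      = h
minHeight h (s ∷ w) = h ℤ.⊓ minHeight (h ℤ.+ δ s) w

inA : ℕ → ℕ → List Step → Bool
inA m d w = ⌊ endHeight (+ m) w ℤ.≟ + 0 ⌋ ∧ ⌊ minHeight (+ m) w ℤ.≟ - (+ d) ⌋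

size : List Step → ℕ
size []      = 0
size (U ∷ w) = size w
size (D ∷ w) = suc (size w)
size (F ∷ w) = suc (size w)

leadingD : List Step → ℕ
leadingD (D ∷ w) = suc (leadingD w)
leadingD _       = 0

-- number of pyramid ascents.  An ascent U^a (maximal run of upsteps) is the
-- first half of a pyramid iff the maximal run of downsteps D^b directly
-- following it has b ≥ a (then U^a D^a is a maximal subpath of the form U^k D^k).
mutual
  pa : List Step → ℕ
  pa []      = 0
  pa (U ∷ w) = paAsc 1 w
  pa (D ∷ w) = pa w
  pa (F ∷ w) = pa w

  paAsc : ℕ → List Step → ℕ
  paAsc a (U ∷ w) = paAsc (suc a) w
  paAsc a w       = (if ⌊ a ℕ.≤? leadingD w ⌋ then 1 else 0) ℕ.+ pa w

filterᵇ : {A : Set} → (A → Bool) → List A → List A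
filterᵇ p []       = []
filterᵇ p (a ∷ as) = if p a then a ∷ filterᵇ p as else filterᵇ p as

wordsOfLength : ℕ → List (List Step)
wordsOfLength zero    = [] ∷ []
wordsOfLength (suc L) = concatMap (λ w → (U ∷ w) ∷ (D ∷ w) ∷ (F ∷ w) ∷ []) (wordsOfLength L)

wordsUpTo : ℕ → List (List Step)
wordsUpTo L = concatMap wordsOfLength (upTo (suc L))

-- The paths of A_{m,d} of size s.  Such a path has #U = #D - m, hence length
-- #U + #D + #F ≤ 2·#D + #F ≤ 2s, so they all occur in wordsUpTo (2 s).
pathsOfSize : ℕ → ℕ → ℕ → List (List Step)
pathsOfSize m d s = filterᵇ (λ w → inA m d w ∧ ⌊ size w ℕ.≟ s ⌋) (wordsUpTo (2 ℕ.* s))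

-- Generating functions.  Coefficients live in an arbitrary commutative
-- ring R, and the variables z_i are arbitrary elements z i of R (i.e. we
-- work in R[[x,y]], the identity for all R and z being the identity in
-- ℤ[z_{-d},z_{-d+1},…][[x,y]]).

module GF {c ℓ : Level} (R : CommutativeRing c ℓ) where
  open CommutativeRing R

  ∑ : List Carrier → Carrier
  ∑ = foldr _+_ 0#

  -- Formal power series in x and y: f n k is the coefficient of x^n y^k.
  PS : Set c
  PS = ℕ → ℕ → Carrier

  oneS : PS
  oneS zero zero = 1#
  oneS _    _    = 0#

  xS : PS
  xS (suc zero) zero = 1#
  xS _          _    = 0#

  xyS : PS
  xyS (suc zero) (suc zero) = 1#
  xyS _          _          = 0#

  _-S_ : PS → PS → PS
  (f -S g) n k = f n k - g n k

  _*S_ : PS → PS → PS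
  (f *S g) n k = ∑ (map (λ i → ∑ (map (λ j → f i j * g (n ∸ i) (k ∸ j)) (upTo (suc k)))) (upTo (suc n)))

  powS : PS → ℕ → PS
  powS f zero    = oneS
  powS f (suc s) = f *S powS f s

  -- Substitution t ↦ h into a univariate series Σ_s a s · t^s, for a series h
  -- all of whose monomials have x-degree ≥ 1 (so only s ≤ n contributes to
  -- the coefficient of x^n y^k).
  substS : (ℕ → Carrier) → PS → PS
  substS a h n k = ∑ (map (λ s → a s * powS h s n k) (upTo (suc n)))

  inv1-xy : PS
  inv1-xy = substS (λ _ → 1#) xyS

  weight : (ℤ → Carrier) → ℤ → List Step → Carrier
  weight z h []      = 1#
  weight z h (U ∷ w) = weight z (h ℤ.+ δ U) w
  weight z h (D ∷ w) = weight z (h ℤ.+ δ D) w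
  weight z h (F ∷ w) = z h * weight z h w

  gCoeff : ℕ → ℕ → (ℤ → Carrier) → ℕ → Carrier
  gCoeff m d z s = ∑ (map (weight z (+ m)) (pathsOfSize m d s))

  G : ℕ → ℕ → (ℤ → Carrier) → PS
  G m d z n k = ∑ (map (weight z (+ m)) (filterᵇ (λ w → ⌊ pa w ℕ.≟ k ⌋) (pathsOfSize m d n)))

  LHS : ℕ → ℕ → (ℤ → Carrier) → PS
  LHS m d z = ((oneS -S xS) *S inv1-xy) *S substS (gCoeff m d z) ((xS *S (oneS -S xS)) *S inv1-xy)

-- For a path P of size s, cut P before each D and F and at its end: this gives
-- s + 1 slots, each after a step other than U (or at the start).  Inserting into
-- a slot a sequence of pyramids with marked ascents, with total weight
-- u = 1/(1 - (y-1) x/(1-x)) = (1-x)/(1-xy), yields every path with some pyramid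
-- ascents marked exactly once, without affecting the lowest level or the
-- flatsteps; hence G(x,y) = u g(xu).
--
-- This is carried out for any weight q on words with q(v UD w) = q(v w).  For such
-- q let A q be the series with y marking pa, and N q the same with the initial
-- ascent not counted as a pyramid ascent.  Then A q = u N q, and
--   N q = q([]) + N(q(U·)) + x (A(q(D·)) + A(q(F·))).
-- The series Σ gₛ (xu)ˢ satisfies the same recursion, which has only one
-- solution because the support of q is finite in each size.

module Submission where

open import Defs
open import Algebra.Bundles using (CommutativeRing)
open import Algebra.Structures using (IsCommutativeRing)
import Algebra.Construct.Pointwise as Pointwise
import Algebra.Properties.CommutativeSemigroup as CommutativeSemigroupProperties
import Algebra.Properties.Semiring.Exp as Exp
import Algebra.Solver.Ring.NaturalCoefficients.Default as SemiringSolver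
import Algebra.Properties.Ring as RingProperties
open import Data.Bool using (Bool; true; false; T; _∧_; if_then_else_)
open import Data.Integer as ℤ using (ℤ; +_)
import Data.Integer.Properties as ℤₚ
open import Data.List using (List; []; _∷_; _++_; map; concatMap; upTo; applyUpTo; length)
open import Data.List.Properties using (map-upTo)
open import Data.Nat as ℕ using (ℕ; zero; suc; _≤_; _<_; z≤n; s≤s; _∸_; _≡ᵇ_)
import Data.Nat.Properties as ℕₚ
open import Data.Integer.Solver using () renaming (module +-*-Solver to ℤSolver)
open ℤSolver using () renaming (solve to ℤ-solve; _:+_ to _ℤ:+_; _:=_ to _ℤ:=_; con to ℤcon)
open import Data.Nat.Solver using (module +-*-Solver)
open +-*-Solver using () renaming (solve to ℕ-solve; _:+_ to _ℕ:+_; _:*_ to _ℕ:*_; _:=_ to _ℕ:=_; con to ℕcon)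
open import Data.Product using (_,_)
open import Function using (_∘_)
open import Level using (Level; _⊔_)
open import Relation.Nullary.Decidable using (yes; no; ⌊_⌋; isYes≗does)
open import Relation.Nullary.Negation using (contradiction)
import Relation.Binary.Reasoning.Setoid as SetoidReasoning
open import Relation.Binary.PropositionalEquality as ≡ using (_≡_)

private
  variable
    c ℓ : Level

-- Finite sums with an inclusive upper index.

module FiniteSums (R : CommutativeRing c ℓ) where
  open CommutativeRing R
  open CommutativeSemigroupProperties +-commutativeSemigroup using (interchange)

  sumTo : ℕ → (ℕ → Carrier) → Carrier
  sumTo zero    f = f 0
  sumTo (suc n) f = f 0 + sumTo n (f ∘ suc)

  sumTo-cong : ∀ n {f g} → (∀ i → i ≤ n → f i ≈ g i) → sumTo n f ≈ sumTo n g
  sumTo-cong zero    f≈g = f≈g 0 z≤n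
  sumTo-cong (suc n) f≈g = +-cong (f≈g 0 z≤n) (sumTo-cong n λ i i≤n → f≈g (suc i) (s≤s i≤n))

  sumTo-0 : ∀ n {f} → (∀ i → i ≤ n → f i ≈ 0#) → sumTo n f ≈ 0#
  sumTo-0 zero    f≈0 = f≈0 0 z≤n
  sumTo-0 (suc n) f≈0 =
    trans (+-cong (f≈0 0 z≤n) (sumTo-0 n λ i i≤n → f≈0 (suc i) (s≤s i≤n))) (+-identityˡ 0#)

  sumTo-+ : ∀ n f g → sumTo n (λ i → f i + g i) ≈ sumTo n f + sumTo n g
  sumTo-+ zero    f g = refl
  sumTo-+ (suc n) f g = trans (+-congˡ (sumTo-+ n (f ∘ suc) (g ∘ suc))) (interchange _ _ _ _)

  sumTo-truncate : ∀ {m n} f → m ≤ n → (∀ i → m < i → f i ≈ 0#) → sumTo n f ≈ sumTo m f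
  sumTo-truncate {zero}  {zero}  f m≤n f≈0 = refl
  sumTo-truncate {zero}  {suc n} f m≤n f≈0 =
    trans (+-congˡ (sumTo-0 n λ i _ → f≈0 (suc i) (s≤s z≤n))) (+-identityʳ _)
  sumTo-truncate {suc m} {suc n} f (s≤s m≤n) f≈0 =
    +-congˡ (sumTo-truncate (f ∘ suc) m≤n λ i m<i → f≈0 (suc i) (s≤s m<i))

  sumTo≡∑ : ∀ n f → GF.∑ R (map f (upTo (suc n))) ≈ sumTo n f
  sumTo≡∑ n f = trans (reflexive (≡.cong (GF.∑ R) (map-upTo f (suc n)))) (go n f)
    where
    go : ∀ n f → GF.∑ R (applyUpTo f (suc n)) ≈ sumTo n f
    go zero    f = +-identityʳ _
    go (suc n) f = +-congˡ (go n (f ∘ suc))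

-- Univariate formal power series over a commutative ring.

module PowerSeries (R : CommutativeRing c ℓ) where
  open CommutativeRing R
  open FiniteSums R
  open CommutativeSemigroupProperties +-commutativeSemigroup using (interchange; x∙yz≈y∙xz)
  open SetoidReasoning setoid

  Series : Set _
  Series = ℕ → Carrier

  infix 4 _≋_
  _≋_ : Series → Series → Set _
  f ≋ g = ∀ n → f n ≈ g n

  tail : Series → Series
  tail f n = f (suc n)

  infixl 6 _⊕_
  _⊕_ : Series → Series → Series
  (f ⊕ g) n = f n + g n

  const : Carrier → Series
  const a zero    = a
  const a (suc n) = 0#

  const-cong : ∀ {a b} → a ≈ b → const a ≋ const b
  const-cong p zero    = p
  const-cong p (suc n) = refl

  const-0 : ∀ {a} → a ≈ 0# → const a ≋ λ _ → 0#
  const-0 p zero    = p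
  const-0 p (suc n) = refl

  -- The Cauchy product, peeling off the head of the first factor: f g = f(0) g + x (tail f) g. In
  -- this form the ring laws go by induction on the coefficient index with the series varying.
  infixl 7 _⊛_
  _⊛_ : Series → Series → Series
  (f ⊛ g) zero    = f 0 * g 0
  (f ⊛ g) (suc n) = f 0 * g (suc n) + (tail f ⊛ g) n

  ⊛-cong-≤ : ∀ n {f f′ g g′} → (∀ i → i ≤ n → f i ≈ f′ i) → (∀ i → i ≤ n → g i ≈ g′ i) →
             (f ⊛ g) n ≈ (f′ ⊛ g′) n
  ⊛-cong-≤ zero    p q = *-cong (p 0 z≤n) (q 0 z≤n)
  ⊛-cong-≤ (suc n) p q = +-cong (*-cong (p 0 z≤n) (q (suc n) ℕₚ.≤-refl))
    (⊛-cong-≤ n (λ i i≤n → p (suc i) (s≤s i≤n)) (λ i i≤n → q i (ℕₚ.m≤n⇒m≤1+n i≤n)))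

  ⊛-cong : ∀ {f f′ g g′} → f ≋ f′ → g ≋ g′ → f ⊛ g ≋ f′ ⊛ g′
  ⊛-cong p q n = ⊛-cong-≤ n (λ i _ → p i) (λ i _ → q i)

  ⊛-zeroˡ : ∀ n {f g} → (∀ i → f i ≈ 0#) → (f ⊛ g) n ≈ 0#
  ⊛-zeroˡ zero    p = trans (*-congʳ (p 0)) (zeroˡ _)
  ⊛-zeroˡ (suc n) p = trans (+-cong (trans (*-congʳ (p 0)) (zeroˡ _)) (⊛-zeroˡ n (p ∘ suc))) (+-identityˡ 0#)

  const-⊛ : ∀ a f n → (const a ⊛ f) n ≈ a * f n
  const-⊛ a f zero    = refl
  const-⊛ a f (suc n) = trans (+-congˡ (⊛-zeroˡ n λ _ → refl)) (+-identityʳ _)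

  -- The mirror image of the defining recursion, peeling the second factor; commutativity compares
  -- the two.
  ⊛-suc : ∀ f g n → (f ⊛ g) (suc n) ≈ g 0 * f (suc n) + (f ⊛ tail g) n
  ⊛-suc f g zero    = trans (+-comm _ _) (+-congʳ (*-comm _ _))
  ⊛-suc f g (suc n) = trans (+-congˡ (⊛-suc (tail f) g n)) (x∙yz≈y∙xz _ _ _)

  ⊛-comm : ∀ f g → f ⊛ g ≋ g ⊛ f
  ⊛-comm f g zero    = *-comm _ _
  ⊛-comm f g (suc n) = trans (+-congˡ (⊛-comm (tail f) g n)) (sym (⊛-suc g f n))

  ⊛-distribʳ : ∀ h f g → (f ⊕ g) ⊛ h ≋ f ⊛ h ⊕ g ⊛ h
  ⊛-distribʳ h f g zero    = distribʳ _ _ _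
  ⊛-distribʳ h f g (suc n) =
    trans (+-cong (distribʳ _ _ _) (⊛-distribʳ h (tail f) (tail g) n)) (interchange _ _ _ _)

  ⊛-distribˡ : ∀ h f g → h ⊛ (f ⊕ g) ≋ h ⊛ f ⊕ h ⊛ g
  ⊛-distribˡ h f g n = begin
    (h ⊛ (f ⊕ g)) n        ≈⟨ ⊛-comm h (f ⊕ g) n ⟩
    ((f ⊕ g) ⊛ h) n        ≈⟨ ⊛-distribʳ h f g n ⟩
    (f ⊛ h) n + (g ⊛ h) n  ≈⟨ +-cong (⊛-comm f h n) (⊛-comm g h n) ⟩
    (h ⊛ f) n + (h ⊛ g) n  ∎

  scale-⊛ : ∀ a f g n → ((λ i → a * f i) ⊛ g) n ≈ a * (f ⊛ g) n
  scale-⊛ a f g zero    = *-assoc _ _ _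
  scale-⊛ a f g (suc n) = trans (+-cong (*-assoc _ _ _) (scale-⊛ a (tail f) g n)) (sym (distribˡ _ _ _))

  ⊛-assoc : ∀ f g h → (f ⊛ g) ⊛ h ≋ f ⊛ (g ⊛ h)
  ⊛-assoc f g h zero    = *-assoc _ _ _
  ⊛-assoc f g h (suc n) = begin
    f 0 * g 0 * h (suc n) + (tail (f ⊛ g) ⊛ h) n
      ≈⟨ +-cong (*-assoc _ _ _) (⊛-distribʳ h (λ i → f 0 * g (suc i)) (tail f ⊛ g) n) ⟩
    f 0 * (g 0 * h (suc n)) + (((λ i → f 0 * g (suc i)) ⊛ h) n + ((tail f ⊛ g) ⊛ h) n)
      ≈⟨ +-congˡ (+-cong (scale-⊛ (f 0) (tail g) h n) (⊛-assoc (tail f) g h n)) ⟩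
    f 0 * (g 0 * h (suc n)) + (f 0 * (tail g ⊛ h) n + (tail f ⊛ (g ⊛ h)) n)
      ≈⟨ +-assoc _ _ _ ⟨
    f 0 * (g 0 * h (suc n)) + f 0 * (tail g ⊛ h) n + (tail f ⊛ (g ⊛ h)) n
      ≈⟨ +-congʳ (distribˡ _ _ _) ⟨
    f 0 * (g 0 * h (suc n) + (tail g ⊛ h) n) + (tail f ⊛ (g ⊛ h)) n ∎

  ⊛-identityˡ : ∀ f → const 1# ⊛ f ≋ f
  ⊛-identityˡ f n = trans (const-⊛ 1# f n) (*-identityˡ _)

  ⊛-isCommutativeRing : IsCommutativeRing _≋_ _⊕_ _⊛_ (λ f n → - f n) (λ _ → 0#) (const 1#)
  ⊛-isCommutativeRing = record
    { isRing = record
      { +-isAbelianGroup = Pointwise.isAbelianGroup ℕ +-isAbelianGroup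
      ; *-cong           = ⊛-cong
      ; *-assoc          = ⊛-assoc
      ; *-identity       = ⊛-identityˡ , λ f n → trans (⊛-comm f (const 1#) n) (⊛-identityˡ f n)
      ; distrib          = ⊛-distribˡ , ⊛-distribʳ
      }
    ; *-comm = ⊛-comm
    }

  seriesRing : CommutativeRing _ _
  seriesRing = record { isCommutativeRing = ⊛-isCommutativeRing }

  X : Series
  X zero    = 0#
  X (suc n) = const 1# n

  headless-⊛ : ∀ f g n → f 0 ≈ 0# → (f ⊛ g) (suc n) ≈ (tail f ⊛ g) n
  headless-⊛ f g n f₀≈0 = trans (+-congʳ (trans (*-congʳ f₀≈0) (zeroˡ _))) (+-identityˡ _)

  X-⊛-suc : ∀ f n → (X ⊛ f) (suc n) ≈ f n
  X-⊛-suc f n = trans (headless-⊛ X f n refl) (⊛-identityˡ f n)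

  -- Multiplication by `X` delays coefficients by one, so agreement strictly below `n` is enough.
  -- This strictness feeds the induction on size in `N≋N̂`.
  X-⊛-cong-< : ∀ f g n → (∀ i → i < n → f i ≈ g i) → (X ⊛ f) n ≈ (X ⊛ g) n
  X-⊛-cong-< f g zero    p = trans (zeroˡ _) (sym (zeroˡ _))
  X-⊛-cong-< f g (suc n) p = trans (X-⊛-suc f n) (trans (p n ℕₚ.≤-refl) (sym (X-⊛-suc g n)))

  X-⊛-0 : ∀ f n → (∀ i → i < n → f i ≈ 0#) → (X ⊛ f) n ≈ 0#
  X-⊛-0 f zero    p = zeroˡ _
  X-⊛-0 f (suc n) p = trans (X-⊛-suc f n) (p n ℕₚ.≤-refl)

  ⊛≈sumTo : ∀ f g n → (f ⊛ g) n ≈ sumTo n (λ i → f i * g (n ∸ i))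
  ⊛≈sumTo f g zero    = refl
  ⊛≈sumTo f g (suc n) = +-congˡ (⊛≈sumTo (tail f) g n)

  ⊛-sumTo : ∀ f (a : ℕ → Carrier) (p : ℕ → Series) m n →
            (f ⊛ (λ i → sumTo m (λ s → a s * p s i))) n ≈ sumTo m (λ s → a s * (f ⊛ p s) n)
  ⊛-sumTo f a p m n = trans (go a p m) (sumTo-cong m λ s _ → scaled s)
    where
    scaled : ∀ s → (f ⊛ (λ i → a s * p s i)) n ≈ a s * (f ⊛ p s) n
    scaled s = begin
      (f ⊛ (λ i → a s * p s i)) n  ≈⟨ ⊛-comm f _ n ⟩
      ((λ i → a s * p s i) ⊛ f) n  ≈⟨ scale-⊛ (a s) (p s) f n ⟩
      a s * (p s ⊛ f) n            ≈⟨ *-congˡ (⊛-comm (p s) f n) ⟩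
      a s * (f ⊛ p s) n            ∎
    go : ∀ (a : ℕ → Carrier) (p : ℕ → Series) m →
         (f ⊛ (λ i → sumTo m (λ s → a s * p s i))) n ≈ sumTo m (λ s → (f ⊛ (λ i → a s * p s i)) n)
    go a p zero    = refl
    go a p (suc m) = trans (⊛-distribˡ f _ _ n) (+-congˡ (go (a ∘ suc) (p ∘ suc) m))

  -- Substitution of one series into another.

  open Exp (CommutativeRing.semiring seriesRing) public using (_^_)

  -- The composite Σₛ aₛ hˢ, meaningful when h has no constant term.
  compose : Series → Series → Series
  compose a h n = sumTo n (λ s → a s * (h ^ s) n)

  compose-cong-≤ : ∀ n {a b} h → (∀ i → i ≤ n → a i ≈ b i) → compose a h n ≈ compose b h n
  compose-cong-≤ n h a≈b = sumTo-cong n λ i i≤n → *-congʳ (a≈b i i≤n)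

  compose-⊕ : ∀ a b h → compose (a ⊕ b) h ≋ compose a h ⊕ compose b h
  compose-⊕ a b h n = trans (sumTo-cong n λ _ _ → distribʳ _ _ _) (sumTo-+ n _ _)

  compose-const : ∀ a h → compose (const a) h ≋ const a
  compose-const a h zero    = *-identityʳ a
  compose-const a h (suc n) =
    trans (+-cong (zeroʳ a) (sumTo-0 n λ _ _ → zeroˡ _)) (+-identityˡ 0#)

  module _ {h : Series} (h₀≈0 : h 0 ≈ 0#) where

    -- Each factor `h` lacks a constant term and so raises the order by at least one; this is why
    -- the sum in `compose` may stop at `s = n`.
    ^-order : ∀ s {i} → i < s → (h ^ s) i ≈ 0#
    ^-order (suc s) {zero}  _         = trans (*-congʳ h₀≈0) (zeroˡ _)
    ^-order (suc s) {suc i} (s≤s i<s) = begin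
      (h ⊛ h ^ s) (suc i)       ≈⟨ headless-⊛ h (h ^ s) i h₀≈0 ⟩
      (tail h ⊛ h ^ s) i        ≈⟨ ⊛-cong-≤ i (λ _ _ → refl) (λ j j≤i → ^-order s (ℕₚ.≤-<-trans j≤i i<s)) ⟩
      (tail h ⊛ (λ _ → 0#)) i   ≈⟨ ⊛-comm (tail h) (λ _ → 0#) i ⟩
      ((λ _ → 0#) ⊛ tail h) i   ≈⟨ ⊛-zeroˡ i (λ _ → refl) ⟩
      0#                        ∎

    -- Shifting the coefficients of `a` adds one factor `h` to each power. With `compose-⊕` and
    -- `compose-const` this carries a first-step recursion through the substitution.
    compose-X⊛ : ∀ a → compose (X ⊛ a) h ≋ h ⊛ compose a h
    compose-X⊛ a zero    = begin
      0# * a 0 * 1#             ≈⟨ *-identityʳ _ ⟩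
      0# * a 0                  ≈⟨ zeroˡ _ ⟩
      0#                        ≈⟨ zeroˡ _ ⟨
      0# * compose a h 0        ≈⟨ *-congʳ h₀≈0 ⟨
      h 0 * compose a h 0       ∎
    compose-X⊛ a (suc n) = begin
      0# * a 0 * 0# + sumTo n (λ s → (X ⊛ a) (suc s) * (h ⊛ h ^ s) (suc n))
        ≈⟨ +-congʳ (zeroʳ _) ⟩
      0# + sumTo n (λ s → (X ⊛ a) (suc s) * (h ⊛ h ^ s) (suc n))
        ≈⟨ +-identityˡ _ ⟩
      sumTo n (λ s → (X ⊛ a) (suc s) * (h ⊛ h ^ s) (suc n))
        ≈⟨ sumTo-cong n (λ s _ → *-cong (X-⊛-suc a s) (headless-⊛ h (h ^ s) n h₀≈0)) ⟩
      sumTo n (λ s → a s * (tail h ⊛ h ^ s) n)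
        ≈⟨ ⊛-sumTo (tail h) a (h ^_) n n ⟨
      (tail h ⊛ (λ i → sumTo n (λ s → a s * (h ^ s) i))) n
        -- Each coefficient `i ≤ n` of the composite may be summed up to the common bound `n`: the
        -- extra terms have `s > i` and vanish by `^-order`.
        ≈⟨ ⊛-cong-≤ n (λ _ _ → refl) (λ i i≤n → sumTo-truncate _ i≤n λ s i<s →
             trans (*-congˡ (^-order s i<s)) (zeroʳ _)) ⟩
      (tail h ⊛ compose a h) n
        ≈⟨ headless-⊛ h (compose a h) n h₀≈0 ⟨
      (h ⊛ compose a h) (suc n) ∎

-- Sums over words, and weights graded by size.

Word : Set
Word = List Step

module WordSums (K : CommutativeRing c ℓ) where
  open CommutativeRing K
  open PowerSeries K
  open CommutativeSemigroupProperties +-commutativeSemigroup using (interchange)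
  open SetoidReasoning setoid

  -- Runs over the words of length at most `n`, arranged by first step so that it unfolds like the
  -- recursions on words.
  wordSum : ℕ → (Word → Carrier) → Carrier
  wordSum zero    f = f []
  wordSum (suc n) f =
    f [] + (wordSum n (f ∘ (U ∷_)) + (wordSum n (f ∘ (D ∷_)) + wordSum n (f ∘ (F ∷_))))

  wordSum-cong : ∀ n {f g} → (∀ w → f w ≈ g w) → wordSum n f ≈ wordSum n g
  wordSum-cong zero    p = p []
  wordSum-cong (suc n) p = +-cong (p []) (+-cong (wordSum-cong n (p ∘ (U ∷_)))
    (+-cong (wordSum-cong n (p ∘ (D ∷_))) (wordSum-cong n (p ∘ (F ∷_)))))

  0+[0+0]≈0 : ∀ {x y z} → x ≈ 0# → y ≈ 0# → z ≈ 0# → x + (y + z) ≈ 0#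
  0+[0+0]≈0 p q r = trans (+-cong p (trans (+-cong q r) (+-identityˡ 0#))) (+-identityˡ 0#)

  wordSum-0 : ∀ n {f} → (∀ w → f w ≈ 0#) → wordSum n f ≈ 0#
  wordSum-0 zero    p = p []
  wordSum-0 (suc n) p = trans (+-cong (p []) (0+[0+0]≈0 (wordSum-0 n (p ∘ (U ∷_)))
    (wordSum-0 n (p ∘ (D ∷_))) (wordSum-0 n (p ∘ (F ∷_))))) (+-identityˡ 0#)

  wordSum-truncate : ∀ {m n} {f} → m ≤ n → (∀ w → m < length w → f w ≈ 0#) →
                     wordSum n f ≈ wordSum m f
  wordSum-truncate {zero}  {zero}  m≤n       p = refl
  wordSum-truncate {zero}  {suc n} m≤n       p = trans
    (+-congˡ (0+[0+0]≈0 (wordSum-0 n λ w → p (U ∷ w) (s≤s z≤n))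
      (wordSum-0 n λ w → p (D ∷ w) (s≤s z≤n)) (wordSum-0 n λ w → p (F ∷ w) (s≤s z≤n))))
    (+-identityʳ _)
  wordSum-truncate {suc m} {suc n} (s≤s m≤n) p = +-congˡ (+-cong
    (wordSum-truncate m≤n λ w → p (U ∷ w) ∘ s≤s) (+-cong
    (wordSum-truncate m≤n λ w → p (D ∷ w) ∘ s≤s)
    (wordSum-truncate m≤n λ w → p (F ∷ w) ∘ s≤s)))

  wordSum-+ : ∀ n f g → wordSum n (λ w → f w + g w) ≈ wordSum n f + wordSum n g
  wordSum-+ zero    f g = refl
  wordSum-+ (suc n) f g = trans
    (+-congˡ (trans (+-cong (wordSum-+ n _ _) (trans (+-cong (wordSum-+ n _ _) (wordSum-+ n _ _))
      (interchange _ _ _ _))) (interchange _ _ _ _)))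
    (interchange _ _ _ _)

  wordSum-* : ∀ n a f → wordSum n (λ w → a * f w) ≈ a * wordSum n f
  wordSum-* zero    a f = refl
  wordSum-* (suc n) a f = begin
    a * f [] + (wordSum n _ + (wordSum n _ + wordSum n _))
      ≈⟨ +-congˡ (+-cong (wordSum-* n a _) (+-cong (wordSum-* n a _) (wordSum-* n a _))) ⟩
    a * f [] + (a * _ + (a * _ + a * _))  ≈⟨ +-congˡ (+-congˡ (distribˡ a _ _)) ⟨
    a * f [] + (a * _ + a * (_ + _))      ≈⟨ +-congˡ (distribˡ a _ _) ⟨
    a * f [] + a * (_ + (_ + _))          ≈⟨ distribˡ a _ _ ⟨
    a * (f [] + (_ + (_ + _)))            ∎

  atSize : ℕ → (Word → Carrier) → Word → Carrier
  atSize n f w = if size w ≡ᵇ n then f w else 0#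

  atSize-cong : ∀ n f g w → (size w ≡ n → f w ≈ g w) → atSize n f w ≈ atSize n g w
  atSize-cong n f g w p with size w ≡ᵇ n in eq
  ... | true  = p (ℕₚ.≡ᵇ⇒≡ (size w) n (≡.subst T (≡.sym eq) _))
  ... | false = refl

  atSize-0 : ∀ n f w → (size w ≡ n → f w ≈ 0#) → atSize n f w ≈ 0#
  atSize-0 n f w p with size w ≡ᵇ n in eq
  ... | true  = p (ℕₚ.≡ᵇ⇒≡ (size w) n (≡.subst T (≡.sym eq) _))
  ... | false = refl

  atSize-+ : ∀ n f g w → atSize n (λ v → f v + g v) w ≈ atSize n f w + atSize n g w
  atSize-+ n f g w with size w ≡ᵇ n
  ... | true  = refl
  ... | false = sym (+-identityˡ 0#)

  atSize-* : ∀ n a f w → atSize n (λ v → a * f v) w ≈ a * atSize n f w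
  atSize-* n a f w with size w ≡ᵇ n
  ... | true  = refl
  ... | false = sym (zeroʳ a)

  -- The support condition makes the sum over all words of a given size finite.
  record Weight : Set (c ⊔ ℓ) where
    field
      fn    : Word → Carrier
      slack : ℕ
      supp  : ∀ w → slack ℕ.+ 2 ℕ.* size w < length w → fn w ≈ 0#
  open Weight public

  -- The left derivative by a letter. Prepending `D` or `F` adds 2 to the support bound but only 1
  -- to the length, which one more unit of slack pays for. `U` gets the same unit, and its cut-off
  -- then agrees by computation with the one left over in `gf-firstStep`.
  ∂ : Step → Weight → Weight
  ∂ s q = record
    { fn    = fn q ∘ (s ∷_)
    ; slack = suc (slack q)
    ; supp  = λ w long → supp q (s ∷ w) (ℕₚ.<-≤-trans (s≤s (bound s w)) (s≤s long))
    }
    where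
    bound : ∀ s w → slack q ℕ.+ 2 ℕ.* size (s ∷ w) ≤ suc (suc (slack q ℕ.+ 2 ℕ.* size w))
    step : ∀ k → slack q ℕ.+ 2 ℕ.* suc k ≤ suc (suc (slack q ℕ.+ 2 ℕ.* k))
    step k = ℕₚ.≤-reflexive (ℕ-solve 2 (λ a b → a ℕ:+ ℕcon 2 ℕ:* (ℕcon 1 ℕ:+ b) ℕ:= ℕcon 2 ℕ:+ (a ℕ:+ ℕcon 2 ℕ:* b)) ≡.refl (slack q) k)
    bound U w = ℕₚ.m≤n⇒m≤1+n (ℕₚ.n≤1+n _)
    bound D w = step (size w)
    bound F w = step (size w)

  infixl 7 _⋆_
  _⋆_ : Weight → (Word → Carrier) → Weight
  q ⋆ φ = record
    { fn    = λ w → fn q w * φ w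
    ; slack = slack q
    ; supp  = λ w long → trans (*-congʳ (supp q w long)) (zeroˡ _)
    }

  gf : Weight → Series
  gf q n = wordSum (slack q ℕ.+ 2 ℕ.* n) (atSize n (fn q))

  -- Words beyond the cut-off of `gf` carry weight zero, so weights with different slacks can be
  -- compared at a common larger length.
  gf-stable : ∀ q {n N} → slack q ℕ.+ 2 ℕ.* n ≤ N → wordSum N (atSize n (fn q)) ≈ gf q n
  gf-stable q {n} n≤N = wordSum-truncate n≤N λ w long →
    atSize-0 n (fn q) w λ { ≡.refl → supp q w long }

  gf-cong : ∀ {p q} → (∀ w → fn p w ≈ fn q w) → gf p ≋ gf q
  gf-cong {p} {q} p≈q n = begin
    gf p n                      ≈⟨ gf-stable p (ℕₚ.m≤m+n _ _) ⟨
    wordSum N (atSize n (fn p)) ≈⟨ wordSum-cong N (λ w → atSize-cong n (fn p) (fn q) w λ _ → p≈q w) ⟩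
    wordSum N (atSize n (fn q)) ≈⟨ gf-stable q (ℕₚ.m≤n+m _ (slack p ℕ.+ 2 ℕ.* n)) ⟩
    gf q n                      ∎
    where
    N : ℕ
    N = (slack p ℕ.+ 2 ℕ.* n) ℕ.+ (slack q ℕ.+ 2 ℕ.* n)

  gf-0 : ∀ q n → (∀ w → size w ≤ n → fn q w ≈ 0#) → gf q n ≈ 0#
  gf-0 q n q≈0 = wordSum-0 (slack q ℕ.+ 2 ℕ.* n) λ w → atSize-0 n (fn q) w λ { ≡.refl → q≈0 w ℕₚ.≤-refl }

  gf-+ : ∀ q φ ψ → gf (q ⋆ (λ w → φ w + ψ w)) ≋ gf (q ⋆ φ) ⊕ gf (q ⋆ ψ)
  gf-+ q φ ψ n = trans
    (wordSum-cong N λ w → trans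
      (atSize-cong n (fn (q ⋆ (λ v → φ v + ψ v))) (λ v → fn (q ⋆ φ) v + fn (q ⋆ ψ) v) w λ _ → distribˡ (fn q w) (φ w) (ψ w))
      (atSize-+ n (fn (q ⋆ φ)) (fn (q ⋆ ψ)) w))
    (wordSum-+ N _ _)
    where
    N : ℕ
    N = slack q ℕ.+ 2 ℕ.* n

  gf-* : ∀ q a φ → gf (q ⋆ (λ w → a * φ w)) ≋ const a ⊛ gf (q ⋆ φ)
  gf-* q a φ n = trans
    (wordSum-cong N λ w → trans
      (atSize-cong n (fn (q ⋆ (λ v → a * φ v))) (λ v → a * fn (q ⋆ φ) v) w λ _ → x∙yz≈y∙xz (fn q w) a (φ w))
      (atSize-* n a (fn (q ⋆ φ)) w))
    (trans (wordSum-* N a _) (sym (const-⊛ a _ n)))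
    where
    open CommutativeSemigroupProperties *-commutativeSemigroup using (x∙yz≈y∙xz)
    N : ℕ
    N = slack q ℕ.+ 2 ℕ.* n

  -- Words are sorted by first step: `U` leaves the size alone, while `D` and `F` raise it by one
  -- and so bring a factor `X`.
  gf-firstStep : ∀ q → gf q ≋ const (fn q []) ⊕ (gf (∂ U q) ⊕ X ⊛ (gf (∂ D q) ⊕ gf (∂ F q)))
  gf-firstStep q n = begin
    gf q n
      ≈⟨ gf-stable q (ℕₚ.m≤n⇒m≤1+n (ℕₚ.n≤1+n _)) ⟨
    wordSum (suc N) (atSize n (fn q))
      ≈⟨ +-cong (emptyWord n) (+-congˡ (downFlat n)) ⟩
    const (fn q []) n + (gf (∂ U q) n + (X ⊛ (gf (∂ D q) ⊕ gf (∂ F q))) n) ∎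
    where
    N : ℕ
    N = suc (slack q ℕ.+ 2 ℕ.* n)

    emptyWord : ∀ n → atSize n (fn q) [] ≈ const (fn q []) n
    emptyWord zero    = refl
    emptyWord (suc n) = refl

    downFlat : ∀ n → let N = suc (slack q ℕ.+ 2 ℕ.* n) in
      wordSum N (atSize n (fn q) ∘ (D ∷_)) + wordSum N (atSize n (fn q) ∘ (F ∷_)) ≈
      (X ⊛ (gf (∂ D q) ⊕ gf (∂ F q))) n
    downFlat zero    = trans (+-cong (wordSum-0 M λ _ → refl) (wordSum-0 M λ _ → refl))
                             (trans (+-identityˡ 0#) (sym (zeroˡ _)))
      where
      M : ℕ
      M = suc (slack q ℕ.+ 0)
    downFlat (suc n) = trans (+-cong (gf-stable (∂ D q) n≤1+n) (gf-stable (∂ F q) n≤1+n))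
                             (sym (X-⊛-suc (gf (∂ D q) ⊕ gf (∂ F q)) n))
      where
      n≤1+n : suc (slack q ℕ.+ 2 ℕ.* n) ≤ suc (slack q ℕ.+ 2 ℕ.* suc n)
      n≤1+n = s≤s (ℕₚ.+-monoʳ-≤ (slack q) (ℕₚ.*-monoʳ-≤ 2 (ℕₚ.n≤1+n n)))

⌊suc≤?suc⌋ : ∀ a b → ⌊ suc a ℕ.≤? suc b ⌋ ≡ ⌊ a ℕ.≤? b ⌋
⌊suc≤?suc⌋ zero    b = ≡.refl
⌊suc≤?suc⌋ (suc a) b = ≡.trans (isYes≗does (suc (suc a) ℕ.≤? suc b)) (≡.sym (isYes≗does (suc a ℕ.≤? b)))

-- Elimination in a commutative ring.

module RingIdentity (R : CommutativeRing c ℓ) where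
  open CommutativeRing R
  open RingProperties ring using (+-cancelʳ)
  open SetoidReasoning setoid
  open SemiringSolver commutativeSemiring using (solve; _:+_; _:*_; _:=_; con)

  -- With p = 1 - x, m = y - 1 and i = 1/(1 - xy), eliminating E gives
  -- (1 - xy) A = (1 - x) N; stated without subtraction.
  eliminate : ∀ {x y p m i A N E} → p + x ≈ 1# → 1# + m ≈ y → i ≈ 1# + x * y * i →
              A ≈ N + E → E ≈ x * E + x * (m * A) → A ≈ p * i * N
  eliminate {x} {y} {p} {m} {i} {A} {N} {E} p+x≈1 1+m≈y i-inverse A≈N+E E-eq =
    -- Adding x i N to both sides turns `p` into p + x = 1.
    +-cancelʳ (x * i * N) A (p * i * N) (begin
      A + x * i * N              ≈⟨ +-cancelʳ (x * y * A * i) _ _ withInverse ⟩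
      i * N                      ≈⟨ *-identityˡ _ ⟨
      1# * (i * N)               ≈⟨ *-congʳ p+x≈1 ⟨
      (p + x) * (i * N)          ≈⟨ solve 4 (λ x p i N → (p :+ x) :* (i :* N) := p :* i :* N :+ x :* i :* N) refl x p i N ⟩
      p * i * N + x * i * N      ∎)
    where
    crossMultiplied : A + x * N ≈ N + x * y * A
    crossMultiplied = begin
      A + x * N                             ≈⟨ +-congʳ (trans A≈N+E (+-congˡ E-eq)) ⟩
      N + (x * E + x * (m * A)) + x * N     ≈⟨ solve 5 (λ x m A N E →
        N :+ (x :* E :+ x :* (m :* A)) :+ x :* N := N :+ (x :* (N :+ E) :+ x :* (m :* A))) refl x m A N E ⟩
      N + (x * (N + E) + x * (m * A))       ≈⟨ +-congˡ (+-congʳ (*-congˡ A≈N+E)) ⟨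
      N + (x * A + x * (m * A))             ≈⟨ solve 4 (λ x m A N →
        N :+ (x :* A :+ x :* (m :* A)) := N :+ x :* (con 1 :+ m) :* A) refl x m A N ⟩
      N + x * (1# + m) * A                  ≈⟨ +-congˡ (*-congʳ (*-congˡ 1+m≈y)) ⟩
      N + x * y * A                         ∎

    -- The cross-multiplied identity times `i`; the summand x y A i on both sides completes A to A
    -- (1 + x y i) = A i.
    withInverse : (A + x * i * N) + x * y * A * i ≈ i * N + x * y * A * i
    withInverse = begin
      (A + x * i * N) + x * y * A * i       ≈⟨ solve 5 (λ x y i A N →
        (A :+ x :* i :* N) :+ x :* y :* A :* i := A :* (con 1 :+ x :* y :* i) :+ x :* i :* N) refl x y i A N ⟩
      A * (1# + x * y * i) + x * i * N      ≈⟨ +-congʳ (*-congˡ i-inverse) ⟨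
      A * i + x * i * N                     ≈⟨ solve 4 (λ x i A N →
        A :* i :+ x :* i :* N := (A :+ x :* N) :* i) refl x i A N ⟩
      (A + x * N) * i                       ≈⟨ *-congʳ crossMultiplied ⟩
      (N + x * y * A) * i                   ≈⟨ solve 5 (λ x y i A N →
        (N :+ x :* y :* A) :* i := i :* N :+ x :* y :* A :* i) refl x y i A N ⟩
      i * N + x * y * A * i                 ∎

-- Pyramid ascents and the surplus of the initial ascent.

module PyramidAscents (K : CommutativeRing c ℓ) (y m : CommutativeRing.Carrier K)
  (1+m≈y : CommutativeRing._≈_ K (CommutativeRing._+_ K (CommutativeRing.1# K) m) y) where
  open CommutativeRing K
  open PowerSeries K hiding (_^_)
  open WordSums K
  open Exp semiring using (_^_)

  -- pa of the word left after removing its initial ascent.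
  paStripped : Word → ℕ
  paStripped (U ∷ w) = paStripped w
  paStripped w       = pa w

  pyramidal stripped : Word → Carrier
  pyramidal w = y ^ pa w
  stripped  w = y ^ paStripped w

  -- The surplus in y^pa when the word is preceded by an ascent of length b that
  -- ends there (closedSurplus), or of length b + 1 that the word may prolong (surplus).
  closedSurplus : ℕ → Word → Carrier
  closedSurplus zero    w       = m * pyramidal w
  closedSurplus (suc b) (D ∷ w) = closedSurplus b w
  closedSurplus (suc b) _       = 0#

  surplus : ℕ → Word → Carrier
  surplus b (U ∷ w) = surplus (suc b) w
  surplus b (D ∷ w) = closedSurplus b w
  surplus b _       = 0#

  -- Each leading `D` cancels one upstep of the preceding ascent. If all are cancelled, the ascent
  -- counts and its factor y is 1 + m; otherwise there is no surplus.
  closedSurplus-pa : ∀ b w → y ^ ((if ⌊ b ℕ.≤? leadingD w ⌋ then 1 else 0) ℕ.+ pa w) ≈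
                             pyramidal w + closedSurplus b w
  closedSurplus-pa zero    w = begin
    y * pyramidal w                    ≈⟨ *-congʳ 1+m≈y ⟨
    (1# + m) * pyramidal w             ≈⟨ distribʳ _ _ _ ⟩
    1# * pyramidal w + m * pyramidal w ≈⟨ +-congʳ (*-identityˡ _) ⟩
    pyramidal w + m * pyramidal w      ∎
    where open SetoidReasoning setoid
  closedSurplus-pa (suc b) []      = sym (+-identityʳ _)
  closedSurplus-pa (suc b) (U ∷ w) = sym (+-identityʳ _)
  closedSurplus-pa (suc b) (D ∷ w) = trans (reflexive (≡.cong
    (λ t → y ^ ((if t then 1 else 0) ℕ.+ pa w)) (⌊suc≤?suc⌋ b (leadingD w)))) (closedSurplus-pa b w)
  closedSurplus-pa (suc b) (F ∷ w) = sym (+-identityʳ _)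

  -- Index `b` stands for `b + 1` upsteps, so a further `U` lengthens the ascent on both sides alike
  -- and a `D` closes it; the end of the word or an `F` leaves it without a pyramid.
  surplus-paAsc : ∀ b w → y ^ paAsc (suc b) w ≈ stripped w + surplus b w
  surplus-paAsc b []      = sym (+-identityʳ _)
  surplus-paAsc b (U ∷ w) = surplus-paAsc (suc b) w
  surplus-paAsc b (D ∷ w) = closedSurplus-pa (suc b) (D ∷ w)
  surplus-paAsc b (F ∷ w) = sym (+-identityʳ _)

  A N : Weight → Series
  A q = gf (q ⋆ pyramidal)
  N q = gf (q ⋆ stripped)

  E C : ℕ → Weight → Series
  E b q = gf (q ⋆ surplus b)
  C b q = gf (q ⋆ closedSurplus b)

  -- After `U` the initial ascent is still being stripped, hence `N`; after `D` or `F` every later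
  -- ascent counts, hence `A`.
  N-recursion : ∀ q → N q ≋ const (fn q []) ⊕ (N (∂ U q) ⊕ X ⊛ (A (∂ D q) ⊕ A (∂ F q)))
  N-recursion q n = trans (gf-firstStep (q ⋆ stripped) n) (+-congʳ (const-cong (*-identityʳ _) n))

  gf-onlyUD : ∀ q → fn q [] ≈ 0# → (∀ w → fn q (F ∷ w) ≈ 0#) → gf q ≋ gf (∂ U q) ⊕ X ⊛ gf (∂ D q)
  gf-onlyUD q []≈0 F≈0 n = begin
    gf q n
      ≈⟨ gf-firstStep q n ⟩
    const (fn q []) n + (gf (∂ U q) n + (X ⊛ (gf (∂ D q) ⊕ gf (∂ F q))) n)
      ≈⟨ +-cong (const-0 []≈0 n) (+-congˡ (X-⊛-cong-< (gf (∂ D q) ⊕ gf (∂ F q)) (gf (∂ D q)) n λ i _ →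
           trans (+-congˡ (gf-0 (∂ F q) i λ w _ → F≈0 w)) (+-identityʳ _))) ⟩
    0# + (gf (∂ U q) n + (X ⊛ gf (∂ D q)) n)
      ≈⟨ +-identityˡ _ ⟩
    gf (∂ U q) n + (X ⊛ gf (∂ D q)) n ∎
    where open SetoidReasoning setoid

  -- An open ascent is prolonged by `U` or closed by `D`, that first `D` already matching one of its
  -- `b + 1` upsteps; the other cases have no surplus.
  E-recursion : ∀ b q → E b q ≋ E (suc b) (∂ U q) ⊕ X ⊛ C b (∂ D q)
  E-recursion b q = gf-onlyUD (q ⋆ surplus b) (zeroʳ _) (λ _ → zeroʳ _)

  C-zero : ∀ q → C 0 q ≋ const m ⊛ A q
  C-zero q = gf-* q m pyramidal

  C-suc : ∀ b q → C (suc b) q ≋ X ⊛ C b (∂ D q)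
  C-suc b q n = trans (gf-onlyUD (q ⋆ closedSurplus (suc b)) (zeroʳ _) (λ _ → zeroʳ _) n)
    (trans (+-congʳ (gf-0 (∂ U (q ⋆ closedSurplus (suc b))) n λ _ _ → zeroʳ _)) (+-identityˡ _))

  initialSurplus : Word → Carrier
  initialSurplus (U ∷ w) = surplus 0 w
  initialSurplus _       = 0#

  pyramidal-split : ∀ w → pyramidal w ≈ stripped w + initialSurplus w
  pyramidal-split []      = sym (+-identityʳ _)
  pyramidal-split (U ∷ w) = surplus-paAsc 0 w
  pyramidal-split (D ∷ w) = sym (+-identityʳ _)
  pyramidal-split (F ∷ w) = sym (+-identityʳ _)

  -- Only words starting with `U` have an initial ascent to be stripped, so the two series differ by
  -- the surplus of that ascent alone.
  A≋N⊕E : ∀ q → A q ≋ N q ⊕ E 0 (∂ U q)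
  A≋N⊕E q n = begin
    A q n
      ≈⟨ gf-cong {q ⋆ pyramidal} {q ⋆ (λ w → stripped w + initialSurplus w)}
           (λ w → *-congˡ (pyramidal-split w)) n ⟩
    gf (q ⋆ (λ w → stripped w + initialSurplus w)) n
      ≈⟨ gf-+ q stripped initialSurplus n ⟩
    N q n + gf (q ⋆ initialSurplus) n
      ≈⟨ +-congˡ (gf-onlyUD (q ⋆ initialSurplus) (zeroʳ _) (λ _ → zeroʳ _) n) ⟩
    N q n + (E 0 (∂ U q) n + (X ⊛ gf (∂ D (q ⋆ initialSurplus))) n)
      ≈⟨ +-congˡ (+-congˡ (X-⊛-0 (gf (∂ D (q ⋆ initialSurplus))) n λ i _ →
           gf-0 (∂ D (q ⋆ initialSurplus)) i λ _ _ → zeroʳ _)) ⟩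
    N q n + (E 0 (∂ U q) n + 0#)
      ≈⟨ +-congˡ (+-identityʳ _) ⟩
    N q n + E 0 (∂ U q) n ∎
    where open SetoidReasoning setoid

  -- Peak invariance and the equation for the initial surplus.

  -- The arbitrary prefix `v` makes the property pass to `∂ s q`, by prefixing `s` to `v`.
  PeakInvariant : Weight → Set _
  PeakInvariant q = ∀ v w → fn q (v ++ U ∷ D ∷ w) ≈ fn q (v ++ w)

  -- Words of bounded size in the support of q are short, so that a recursion
  -- that prolongs an initial run of upsteps can be unfolded until nothing is left.
  ascentInduction : (P : ℕ → Weight → Set ℓ) → ∀ n →
    (∀ b q → (∀ w → size w ≤ n → fn q w ≈ 0#) → P b q) →
    (∀ b q → PeakInvariant q → P (suc b) (∂ U q) → P b q) →
    ∀ b q → PeakInvariant q → P b q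
  -- A word of size at most `n` and at least this length exceeds the support bound of `q`.
  ascentInduction P n base step b q = go (suc (slack q ℕ.+ 2 ℕ.* n)) b q
    (λ w size≤n long → supp q w (ℕₚ.≤-<-trans (ℕₚ.+-monoʳ-≤ (slack q) (ℕₚ.*-monoʳ-≤ 2 size≤n)) long))
    where
    go : ∀ j b q → (∀ w → size w ≤ n → j ≤ length w → fn q w ≈ 0#) → PeakInvariant q → P b q
    go zero    b q q≈0 inv = base b q λ w size≤n → q≈0 w size≤n z≤n
    go (suc j) b q q≈0 inv = step b q inv
      (go j (suc b) (∂ U q) (λ w size≤n long → q≈0 (U ∷ w) size≤n (s≤s long)) (inv ∘ (U ∷_)))

  -- Cutting the `U D` at the top of the initial ascent shortens the ascent and the descent after it
  -- by one each. This keeps the surplus and the weight, and lowers the size by one.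
  E-shift : ∀ b q → PeakInvariant q → E (suc b) (∂ U q) ≋ X ⊛ E b q
  E-shift b q inv n = ascentInduction (λ b q → E (suc b) (∂ U q) n ≈ (X ⊛ E b q) n) n base step b q inv
    where
    open SetoidReasoning setoid
    base : ∀ b q → (∀ w → size w ≤ n → fn q w ≈ 0#) → E (suc b) (∂ U q) n ≈ (X ⊛ E b q) n
    base b q q≈0 = trans
      (gf-0 (∂ U q ⋆ surplus (suc b)) n λ w size≤n → trans (*-congʳ (q≈0 (U ∷ w) size≤n)) (zeroˡ _))
      (sym (X-⊛-0 (E b q) n λ i i<n → gf-0 (q ⋆ surplus b) i λ w size≤i →
        trans (*-congʳ (q≈0 w (ℕₚ.≤-trans size≤i (ℕₚ.<⇒≤ i<n)))) (zeroˡ _)))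
    step : ∀ b q → PeakInvariant q → E (suc (suc b)) (∂ U (∂ U q)) n ≈ (X ⊛ E (suc b) (∂ U q)) n →
           E (suc b) (∂ U q) n ≈ (X ⊛ E b q) n
    step b q inv ih = begin
      E (suc b) (∂ U q) n
        ≈⟨ E-recursion (suc b) (∂ U q) n ⟩
      E (suc (suc b)) (∂ U (∂ U q)) n + (X ⊛ C (suc b) (∂ D (∂ U q))) n
        -- Peak invariance with empty prefix identifies the weight after `U D` with `q`; `C-suc`
        -- then reads one more `D` of the descent.
        ≈⟨ +-cong ih (X-⊛-cong-< _ _ n λ i _ → trans
             (gf-cong {∂ D (∂ U q) ⋆ closedSurplus (suc b)} {q ⋆ closedSurplus (suc b)}
               (λ w → *-congʳ (inv [] w)) i)
             (C-suc b q i)) ⟩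
      (X ⊛ E (suc b) (∂ U q)) n + (X ⊛ (X ⊛ C b (∂ D q))) n
        ≈⟨ ⊛-distribˡ X (E (suc b) (∂ U q)) (X ⊛ C b (∂ D q)) n ⟨
      (X ⊛ (E (suc b) (∂ U q) ⊕ X ⊛ C b (∂ D q))) n
        ≈⟨ X-⊛-cong-< (E b q) _ n (λ i _ → E-recursion b q i) ⟨
      (X ⊛ E b q) n ∎

  -- An initial pyramid of height one is deleted outright, leaving `q` with the factor x m; the top
  -- peak of a higher one is cut by `E-shift`.
  E-equation : ∀ q → PeakInvariant q → E 0 (∂ U q) ≋ X ⊛ E 0 (∂ U q) ⊕ X ⊛ (const m ⊛ A q)
  E-equation q inv n = begin
    E 0 (∂ U q) n
      ≈⟨ E-recursion 0 (∂ U q) n ⟩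
    E 1 (∂ U (∂ U q)) n + (X ⊛ C 0 (∂ D (∂ U q))) n
      ≈⟨ +-cong (E-shift 0 (∂ U q) (inv ∘ (U ∷_)) n) (X-⊛-cong-< _ _ n λ i _ → trans
           (gf-cong {∂ D (∂ U q) ⋆ closedSurplus 0} {q ⋆ closedSurplus 0} (λ w → *-congʳ (inv [] w)) i)
           (C-zero q i)) ⟩
    (X ⊛ E 0 (∂ U q)) n + (X ⊛ (const m ⊛ A q)) n ∎
    where open SetoidReasoning setoid

  -- The factor u, the substituted series, and uniqueness of the recursion.

  module _ {p i : Series} (p⊕X≋1 : p ⊕ X ≋ const 1#)
           (i-inverse : i ≋ const 1# ⊕ X ⊛ const y ⊛ i) where

    -- `p` is 1 - x and `i` is 1/(1 - xy), so `p ⊛ i` is u. Eliminating the surplus from the two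
    -- linear equations leaves A = u N.
    A≋[p⊛i]⊛N : ∀ q → PeakInvariant q → A q ≋ p ⊛ i ⊛ N q
    A≋[p⊛i]⊛N q inv = RingIdentity.eliminate seriesRing
      {x = X} {y = const y} {p = p} {m = const m} {i = i} {A = A q} {N = N q} {E = E 0 (∂ U q)}
      p⊕X≋1 1⊕m≋y i-inverse (A≋N⊕E q) (E-equation q inv)
      where
      1⊕m≋y : const 1# ⊕ const m ≋ const y
      1⊕m≋y zero    = 1+m≈y
      1⊕m≋y (suc n) = +-identityʳ 0#

    h : Series
    h = X ⊛ p ⊛ i

    h₀≈0 : h 0 ≈ 0#
    h₀≈0 = trans (*-congʳ (zeroˡ _)) (zeroˡ _)

    N̂ : Weight → Series
    N̂ q = compose (gf q) h

    -- The first-step recursion of `gf q` with x replaced by `h`. Besides `X`, the factor `h`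
    -- contains the u that turns `N̂` into the counterpart of `A`, so this has the shape of
    -- `N-recursion`.
    N̂-recursion : ∀ q → N̂ q ≋ const (fn q []) ⊕ (N̂ (∂ U q) ⊕ X ⊛ (p ⊛ i ⊛ N̂ (∂ D q) ⊕ p ⊛ i ⊛ N̂ (∂ F q)))
    N̂-recursion q n = begin
      N̂ q n
        ≈⟨ compose-cong-≤ n h (λ s _ → gf-firstStep q s) ⟩
      compose (const e ⊕ (gf u ⊕ X ⊛ (gf d ⊕ gf f))) h n
        ≈⟨ compose-⊕ (const e) _ h n ⟩
      compose (const e) h n + compose (gf u ⊕ X ⊛ (gf d ⊕ gf f)) h n
        ≈⟨ +-cong (compose-const e h n) (compose-⊕ (gf u) _ h n) ⟩
      const e n + (N̂ u n + compose (X ⊛ (gf d ⊕ gf f)) h n)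
        ≈⟨ +-congˡ (+-congˡ (compose-X⊛ h₀≈0 (gf d ⊕ gf f) n)) ⟩
      const e n + (N̂ u n + (h ⊛ compose (gf d ⊕ gf f) h) n)
        ≈⟨ +-congˡ (+-congˡ (⊛-cong (⊛-assoc X p i) (compose-⊕ (gf d) (gf f) h) n)) ⟩
      const e n + (N̂ u n + (X ⊛ (p ⊛ i) ⊛ (N̂ d ⊕ N̂ f)) n)
        ≈⟨ +-congˡ (+-congˡ (⊛-assoc X (p ⊛ i) (N̂ d ⊕ N̂ f) n)) ⟩
      const e n + (N̂ u n + (X ⊛ (p ⊛ i ⊛ (N̂ d ⊕ N̂ f))) n)
        ≈⟨ +-congˡ (+-congˡ (X-⊛-cong-< _ _ n λ j _ → ⊛-distribˡ (p ⊛ i) (N̂ d) (N̂ f) j)) ⟩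
      const e n + (N̂ u n + (X ⊛ (p ⊛ i ⊛ N̂ d ⊕ p ⊛ i ⊛ N̂ f)) n) ∎
      where
      open SetoidReasoning setoid
      e : Carrier
      e = fn q []
      u d f : Weight
      u = ∂ U q
      d = ∂ D q
      f = ∂ F q

    -- Both sides obey one recursion. Its `D` and `F` terms involve only smaller sizes; its `U` term
    -- keeps the size and is handled by the finite support. Hence an outer induction on a bound for
    -- the size and an inner `ascentInduction`.
    N≋N̂ : ∀ q → PeakInvariant q → N q ≋ N̂ q
    N≋N̂ q inv n = below (suc n) n ℕₚ.≤-refl q inv
      where
      open SetoidReasoning setoid
      below : ∀ k n → n < k → ∀ q → PeakInvariant q → N q n ≈ N̂ q n
      below (suc k) n (s≤s n≤k) = ascentInduction (λ _ q → N q n ≈ N̂ q n) n base step 0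
        where
        base : ∀ (_ : ℕ) q → (∀ w → size w ≤ n → fn q w ≈ 0#) → N q n ≈ N̂ q n
        base _ q q≈0 = trans
          (gf-0 (q ⋆ stripped) n λ w size≤n → trans (*-congʳ (q≈0 w size≤n)) (zeroˡ _))
          (sym (trans (compose-cong-≤ n {gf q} {λ _ → 0#} h λ s s≤n → gf-0 q s λ w size≤s → q≈0 w (ℕₚ.≤-trans size≤s s≤n))
            (trans (compose-cong-≤ n h λ s _ → sym (const-0 refl s)) (trans (compose-const 0# h n) (const-0 refl n)))))
        step : ∀ (_ : ℕ) q → PeakInvariant q → N (∂ U q) n ≈ N̂ (∂ U q) n → N q n ≈ N̂ q n
        step _ q inv ih = begin
          N q n
            ≈⟨ N-recursion q n ⟩
          const (fn q []) n + (N (∂ U q) n + (X ⊛ (A (∂ D q) ⊕ A (∂ F q))) n)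
            ≈⟨ +-congˡ (+-cong ih (X-⊛-cong-< _ _ n λ j j<n →
                 +-cong (after D j j<n) (after F j j<n))) ⟩
          const (fn q []) n + (N̂ (∂ U q) n + (X ⊛ (p ⊛ i ⊛ N̂ (∂ D q) ⊕ p ⊛ i ⊛ N̂ (∂ F q))) n)
            ≈⟨ N̂-recursion q n ⟨
          N̂ q n ∎
          where
          -- Only indices l ≤ j < n ≤ k occur in this product, and these are covered by the outer
          -- hypothesis.
          after : ∀ s j → j < n → A (∂ s q) j ≈ (p ⊛ i ⊛ N̂ (∂ s q)) j
          after s j j<n = trans (A≋[p⊛i]⊛N (∂ s q) (inv ∘ (s ∷_)) j)
            (⊛-cong-≤ j (λ _ _ → refl) λ l l≤j →
              below k l (ℕₚ.<-≤-trans (ℕₚ.≤-<-trans l≤j j<n) n≤k) (∂ s q) (inv ∘ (s ∷_)))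

    -- `compose (gf q) h` is `N̂ q`, hence `N q`, and u N is A.
    pyramidTransform : ∀ q → PeakInvariant q → p ⊛ i ⊛ compose (gf q) h ≋ A q
    pyramidTransform q inv n = sym (trans (A≋[p⊛i]⊛N q inv n)
      (⊛-cong {p ⊛ i} (λ _ → refl) (N≋N̂ q inv) n))

-- Lattice paths: removing a peak, and bounding the length.

up-down : ∀ h → h ℤ.+ δ U ℤ.+ δ D ≡ h
up-down h = ≡.trans (ℤₚ.+-assoc h (+ 1) (δ D)) (ℤₚ.+-identityʳ h)

endHeight-peak : ∀ h v w → endHeight h (v ++ U ∷ D ∷ w) ≡ endHeight h (v ++ w)
endHeight-peak h []      w = ≡.cong (λ k → endHeight k w) (up-down h)
endHeight-peak h (s ∷ v) w = endHeight-peak (h ℤ.+ δ s) v w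

minHeight≤start : ∀ h w → minHeight h w ℤ.≤ h
minHeight≤start h []      = ℤₚ.≤-refl
minHeight≤start h (s ∷ w) = ℤₚ.i⊓j≤i h _

-- The peak only adds a level above its starting height, which the path visits anyway.
minHeight-peak : ∀ h v w → minHeight h (v ++ U ∷ D ∷ w) ≡ minHeight h (v ++ w)
minHeight-peak h [] w = begin
  h ℤ.⊓ ((h ℤ.+ + 1) ℤ.⊓ minHeight (h ℤ.+ δ U ℤ.+ δ D) w)
    ≡⟨ ≡.cong (λ k → h ℤ.⊓ ((h ℤ.+ + 1) ℤ.⊓ minHeight k w)) (up-down h) ⟩
  h ℤ.⊓ ((h ℤ.+ + 1) ℤ.⊓ minHeight h w)
    ≡⟨ ≡.cong (h ℤ.⊓_) (ℤₚ.i≥j⇒i⊓j≡j (ℤₚ.≤-trans (minHeight≤start h w) (ℤₚ.i≤i+j h (+ 1)))) ⟩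
  h ℤ.⊓ minHeight h w
    ≡⟨ ℤₚ.i≥j⇒i⊓j≡j (minHeight≤start h w) ⟩
  minHeight h w ∎
  where open ≡.≡-Reasoning
minHeight-peak h (s ∷ v) w = ≡.cong (h ℤ.⊓_) (minHeight-peak (h ℤ.+ δ s) v w)

inA-peak : ∀ m d v w → inA m d (v ++ U ∷ D ∷ w) ≡ inA m d (v ++ w)
inA-peak m d v w = ≡.cong₂ (λ e l → ⌊ e ℤ.≟ + 0 ⌋ ∧ ⌊ l ℤ.≟ ℤ.- (+ d) ⌋)
  (endHeight-peak (+ m) v w) (minHeight-peak (+ m) v w)

-- `U` adds one to the length and to the end height; `D` adds one to the length, two to the doubled
-- size and minus one to the end height. Both preserve equality, and `F` gives one unit away.
length-bound : ∀ h w → + length w ℤ.+ h ℤ.≤ + (2 ℕ.* size w) ℤ.+ endHeight h w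
length-bound h []      = ℤₚ.≤-refl
length-bound h (U ∷ w) = begin
  + suc (length w) ℤ.+ h                             ≡⟨ ℤ-solve 2 (λ l h →
    (ℤcon (+ 1) ℤ:+ l) ℤ:+ h ℤ:= l ℤ:+ (h ℤ:+ ℤcon (+ 1))) ≡.refl (+ length w) h ⟩
  + length w ℤ.+ (h ℤ.+ + 1)                         ≤⟨ length-bound (h ℤ.+ + 1) w ⟩
  + (2 ℕ.* size w) ℤ.+ endHeight (h ℤ.+ + 1) w       ∎
  where open ℤₚ.≤-Reasoning
length-bound h (D ∷ w) = begin
  + suc (length w) ℤ.+ h                             ≡⟨ ℤ-solve 2 (λ l h →
    (ℤcon (+ 1) ℤ:+ l) ℤ:+ h ℤ:= ℤcon (+ 2) ℤ:+ (l ℤ:+ (h ℤ:+ ℤcon (δ D)))) ≡.refl (+ length w) h ⟩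
  + 2 ℤ.+ (+ length w ℤ.+ (h ℤ.+ δ D))               ≤⟨ ℤₚ.+-monoʳ-≤ (+ 2) (length-bound (h ℤ.+ δ D) w) ⟩
  + 2 ℤ.+ (+ (2 ℕ.* size w) ℤ.+ endHeight (h ℤ.+ δ D) w)
    ≡⟨ ℤₚ.+-assoc (+ 2) (+ (2 ℕ.* size w)) (endHeight (h ℤ.+ δ D) w) ⟨
  + (2 ℕ.+ 2 ℕ.* size w) ℤ.+ endHeight (h ℤ.+ δ D) w
    ≡⟨ ≡.cong (λ k → + k ℤ.+ endHeight (h ℤ.+ δ D) w) (ℕₚ.*-suc 2 (size w)) ⟨
  + (2 ℕ.* suc (size w)) ℤ.+ endHeight (h ℤ.+ δ D) w ∎
  where open ℤₚ.≤-Reasoning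
length-bound h (F ∷ w) = begin
  + suc (length w) ℤ.+ h                             ≡⟨ ℤ-solve 2 (λ l h →
    (ℤcon (+ 1) ℤ:+ l) ℤ:+ h ℤ:= ℤcon (+ 1) ℤ:+ (l ℤ:+ (h ℤ:+ ℤcon (+ 0)))) ≡.refl (+ length w) h ⟩
  + 1 ℤ.+ (+ length w ℤ.+ (h ℤ.+ + 0))               ≤⟨ ℤₚ.+-mono-≤ (ℤ.+≤+ (s≤s z≤n)) (length-bound (h ℤ.+ + 0) w) ⟩
  + 2 ℤ.+ (+ (2 ℕ.* size w) ℤ.+ endHeight (h ℤ.+ + 0) w)
    ≡⟨ ℤₚ.+-assoc (+ 2) (+ (2 ℕ.* size w)) (endHeight (h ℤ.+ + 0) w) ⟨
  + (2 ℕ.+ 2 ℕ.* size w) ℤ.+ endHeight (h ℤ.+ + 0) w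
    ≡⟨ ≡.cong (λ k → + k ℤ.+ endHeight (h ℤ.+ + 0) w) (ℕₚ.*-suc 2 (size w)) ⟨
  + (2 ℕ.* suc (size w)) ℤ.+ endHeight (h ℤ.+ + 0) w ∎
  where open ℤₚ.≤-Reasoning

length≤2*size : ∀ m w → endHeight (+ m) w ≡ + 0 → length w ≤ 2 ℕ.* size w
length≤2*size m w end≡0 = ℤₚ.drop‿+≤+ (begin
  + length w                                  ≤⟨ ℤₚ.i≤i+j (+ length w) (+ m) ⟩
  + length w ℤ.+ + m                          ≤⟨ length-bound (+ m) w ⟩
  + (2 ℕ.* size w) ℤ.+ endHeight (+ m) w      ≡⟨ ≡.cong (ℤ._+_ (+ (2 ℕ.* size w))) end≡0 ⟩
  + (2 ℕ.* size w) ℤ.+ + 0                    ≡⟨ ℤₚ.+-identityʳ _ ⟩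
  + (2 ℕ.* size w)                            ∎)
  where open ℤₚ.≤-Reasoning

⌊≟⌋ : ∀ a b → ⌊ a ℕ.≟ b ⌋ ≡ (a ≡ᵇ b)
⌊≟⌋ a b = isYes≗does (a ℕ.≟ b)

-- Sums over lists of words.

module ListSums (R : CommutativeRing c ℓ) where
  open CommutativeRing R
  open GF R using (∑)
  open FiniteSums R
  open WordSums R using (wordSum)
  open CommutativeSemigroupProperties +-commutativeSemigroup using (interchange)
  open SetoidReasoning setoid

  ∑-map-cong : ∀ {X : Set} {f g : X → Carrier} xs → (∀ x → f x ≈ g x) → ∑ (map f xs) ≈ ∑ (map g xs)
  ∑-map-cong []       p = refl
  ∑-map-cong (x ∷ xs) p = +-cong (p x) (∑-map-cong xs p)

  ∑-map-+ : ∀ {X : Set} (f g : X → Carrier) xs →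
            ∑ (map (λ x → f x + g x) xs) ≈ ∑ (map f xs) + ∑ (map g xs)
  ∑-map-+ f g []       = sym (+-identityˡ 0#)
  ∑-map-+ f g (x ∷ xs) = trans (+-congˡ (∑-map-+ f g xs)) (interchange _ _ _ _)

  ∑-map-++ : ∀ {X : Set} (f : X → Carrier) xs ys → ∑ (map f (xs ++ ys)) ≈ ∑ (map f xs) + ∑ (map f ys)
  ∑-map-++ f []       ys = sym (+-identityˡ _)
  ∑-map-++ f (x ∷ xs) ys = trans (+-congˡ (∑-map-++ f xs ys)) (sym (+-assoc _ _ _))

  ∑-concatMap : ∀ {X Y : Set} (f : Y → Carrier) (g : X → List Y) xs →
                ∑ (map f (concatMap g xs)) ≈ ∑ (map (λ x → ∑ (map f (g x))) xs)
  ∑-concatMap f g []       = refl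
  ∑-concatMap f g (x ∷ xs) = trans (∑-map-++ f (g x) (concatMap g xs)) (+-congˡ (∑-concatMap f g xs))

  ∑-filterᵇ : ∀ {X : Set} (f : X → Carrier) (p : X → Bool) xs →
              ∑ (map f (filterᵇ p xs)) ≈ ∑ (map (λ x → if p x then f x else 0#) xs)
  ∑-filterᵇ f p []       = refl
  ∑-filterᵇ f p (x ∷ xs) with p x
  ... | true  = +-congˡ (∑-filterᵇ f p xs)
  ... | false = trans (∑-filterᵇ f p xs) (sym (+-identityˡ _))

  lengthSum : (Word → Carrier) → ℕ → Carrier
  lengthSum f L = ∑ (map f (wordsOfLength L))

  lengthSum-suc : ∀ f L → lengthSum f (suc L) ≈
    lengthSum (f ∘ (U ∷_)) L + (lengthSum (f ∘ (D ∷_)) L + lengthSum (f ∘ (F ∷_)) L)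
  lengthSum-suc f L = begin
    lengthSum f (suc L)
      ≈⟨ ∑-concatMap f (λ w → (U ∷ w) ∷ (D ∷ w) ∷ (F ∷ w) ∷ []) (wordsOfLength L) ⟩
    ∑ (map (λ w → f (U ∷ w) + (f (D ∷ w) + (f (F ∷ w) + 0#))) (wordsOfLength L))
      ≈⟨ ∑-map-cong (wordsOfLength L) (λ w → +-congˡ (+-congˡ (+-identityʳ _))) ⟩
    ∑ (map (λ w → f (U ∷ w) + (f (D ∷ w) + f (F ∷ w))) (wordsOfLength L))
      ≈⟨ trans (∑-map-+ _ _ (wordsOfLength L)) (+-congˡ (∑-map-+ _ _ (wordsOfLength L))) ⟩
    lengthSum (f ∘ (U ∷_)) L + (lengthSum (f ∘ (D ∷_)) L + lengthSum (f ∘ (F ∷_)) L) ∎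

  -- Links the two enumerations of words: by length in `wordsUpTo`, by first step in `wordSum`.
  sumTo-lengthSum : ∀ n f → sumTo n (lengthSum f) ≈ wordSum n f
  sumTo-lengthSum zero    f = +-identityʳ _
  sumTo-lengthSum (suc n) f = +-cong (+-identityʳ _) (begin
    sumTo n (lengthSum f ∘ suc)
      ≈⟨ sumTo-cong n (λ L _ → lengthSum-suc f L) ⟩
    sumTo n (λ L → lengthSum (f ∘ (U ∷_)) L + (lengthSum (f ∘ (D ∷_)) L + lengthSum (f ∘ (F ∷_)) L))
      ≈⟨ trans (sumTo-+ n _ _) (+-congˡ (sumTo-+ n _ _)) ⟩
    sumTo n (lengthSum (f ∘ (U ∷_))) + (sumTo n (lengthSum (f ∘ (D ∷_))) + sumTo n (lengthSum (f ∘ (F ∷_))))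
      ≈⟨ +-cong (sumTo-lengthSum n _) (+-cong (sumTo-lengthSum n _) (sumTo-lengthSum n _)) ⟩
    wordSum n (f ∘ (U ∷_)) + (wordSum n (f ∘ (D ∷_)) + wordSum n (f ∘ (F ∷_))) ∎)

  ∑-wordsUpTo : ∀ n f → ∑ (map f (wordsUpTo n)) ≈ wordSum n f
  ∑-wordsUpTo n f = begin
    ∑ (map f (wordsUpTo n))               ≈⟨ ∑-concatMap f wordsOfLength (upTo (suc n)) ⟩
    ∑ (map (lengthSum f) (upTo (suc n)))  ≈⟨ sumTo≡∑ n (lengthSum f) ⟩
    sumTo n (lengthSum f)                 ≈⟨ sumTo-lengthSum n f ⟩
    wordSum n f                           ∎

-- From double coefficient arrays to nested power series.

-- PS is read as R[[y]][[x]]: Y is arithmetic in K = R[[y]], and X in K[[x]].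
module Bridge (R : CommutativeRing c ℓ) where
  open CommutativeRing R
  open GF R
  open FiniteSums R
  module Y = PowerSeries R

  K : CommutativeRing c ℓ
  K = Y.seriesRing

  module X = PowerSeries K
  module WR = WordSums R
  module WK = WordSums K
  module FK = FiniteSums K

  sumTo-coeff : ∀ n (f : ℕ → Y.Series) k → FK.sumTo n f k ≡ sumTo n (λ i → f i k)
  sumTo-coeff zero    f k = ≡.refl
  sumTo-coeff (suc n) f k = ≡.cong₂ _+_ ≡.refl (sumTo-coeff n (f ∘ suc) k)

  wordSum-coeff : ∀ n (f : Word → Y.Series) k → WK.wordSum n f k ≡ WR.wordSum n (λ w → f w k)
  wordSum-coeff zero    f k = ≡.refl
  wordSum-coeff (suc n) f k = ≡.cong₂ _+_ ≡.refl (≡.cong₂ _+_ (wordSum-coeff n (f ∘ (U ∷_)) k)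
    (≡.cong₂ _+_ (wordSum-coeff n (f ∘ (D ∷_)) k) (wordSum-coeff n (f ∘ (F ∷_)) k)))

  *S≋⊛ : ∀ f g → (f *S g) X.≋ (f X.⊛ g)
  *S≋⊛ f g n k = begin
    (f *S g) n k
      ≈⟨ sumTo≡∑ n _ ⟩
    sumTo n (λ i → ∑ (map (λ j → f i j * g (n ∸ i) (k ∸ j)) (upTo (suc k))))
      ≈⟨ sumTo-cong n (λ i _ → trans (sumTo≡∑ k _) (sym (Y.⊛≈sumTo (f i) (g (n ∸ i)) k))) ⟩
    sumTo n (λ i → (f i Y.⊛ g (n ∸ i)) k)
      ≡⟨ sumTo-coeff n (λ i → f i Y.⊛ g (n ∸ i)) k ⟨
    FK.sumTo n (λ i → f i Y.⊛ g (n ∸ i)) k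
      ≈⟨ X.⊛≈sumTo f g n k ⟨
    (f X.⊛ g) n k ∎
    where open SetoidReasoning setoid

  oneS≋1 : oneS X.≋ X.const (Y.const 1#)
  oneS≋1 zero    zero    = refl
  oneS≋1 zero    (suc k) = refl
  oneS≋1 (suc n) zero    = refl
  oneS≋1 (suc n) (suc k) = refl

  xS≋X : xS X.≋ X.X
  xS≋X zero          zero    = refl
  xS≋X zero          (suc k) = refl
  xS≋X (suc zero)    zero    = refl
  xS≋X (suc zero)    (suc k) = refl
  xS≋X (suc (suc n)) zero    = refl
  xS≋X (suc (suc n)) (suc k) = refl

  xyS≋Xy : xyS X.≋ X.X X.⊛ X.const Y.X
  xyS≋Xy n k = trans (xyS≋shift n k) (sym (Xy≋shift n k))
    where
    -- The product x y spelled out as a shift, so that coefficients can be matched with those of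
    -- `xyS` by cases.
    shiftedY : ℕ → Y.Series
    shiftedY zero    _ = 0#
    shiftedY (suc n)   = X.const Y.X n
    xyS≋shift : ∀ n k → xyS n k ≈ shiftedY n k
    xyS≋shift zero          k             = refl
    xyS≋shift (suc zero)    zero          = refl
    xyS≋shift (suc zero)    (suc zero)    = refl
    xyS≋shift (suc zero)    (suc (suc k)) = refl
    xyS≋shift (suc (suc n)) k             = refl
    Xy≋shift : ∀ n k → (X.X X.⊛ X.const Y.X) n k ≈ shiftedY n k
    Xy≋shift zero    k = CommutativeRing.zeroˡ K Y.X k
    Xy≋shift (suc n) k = X.X-⊛-suc (X.const Y.X) n k

  powS≋^ : ∀ {f g} → f X.≋ g → ∀ s → powS f s X.≋ g X.^ s
  powS≋^ f≋g zero    = oneS≋1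
  powS≋^ {f} {g} f≋g (suc s) n = CommutativeRing.trans K (*S≋⊛ f (powS f s) n)
    (X.⊛-cong f≋g (powS≋^ f≋g s) n)

  -- Scalars of R enter `compose` as series constant in y, and multiplying by such a constant is
  -- scalar multiplication.
  substS≋compose : ∀ a {b h h′} → (∀ s → Y.const (a s) Y.≋ b s) → h X.≋ h′ →
                   substS a h X.≋ X.compose b h′
  substS≋compose a {b} {h} {h′} a≋b h≋h′ n k = begin
    substS a h n k
      ≈⟨ sumTo≡∑ n _ ⟩
    sumTo n (λ s → a s * powS h s n k)
      ≈⟨ sumTo-cong n (λ s _ → *-congˡ (powS≋^ h≋h′ s n k)) ⟩
    sumTo n (λ s → a s * (h′ X.^ s) n k)
      ≈⟨ sumTo-cong n (λ s _ → Y.const-⊛ (a s) ((h′ X.^ s) n) k) ⟨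
    sumTo n (λ s → (Y.const (a s) Y.⊛ (h′ X.^ s) n) k)
      ≈⟨ sumTo-cong n (λ s _ → Y.⊛-cong (a≋b s) (λ _ → refl) k) ⟩
    sumTo n (λ s → (b s Y.⊛ (h′ X.^ s) n) k)
      ≡⟨ sumTo-coeff n (λ s → b s Y.⊛ (h′ X.^ s) n) k ⟨
    X.compose b h′ n k ∎
    where open SetoidReasoning setoid

  p+X≋1 : (oneS -S xS) X.⊕ X.X X.≋ X.const (Y.const 1#)
  p+X≋1 n k = begin
    oneS n k - xS n k + X.X n k       ≈⟨ +-congˡ (xS≋X n k) ⟨
    oneS n k - xS n k + xS n k        ≈⟨ +-assoc _ _ _ ⟩
    oneS n k + (- xS n k + xS n k)    ≈⟨ +-congˡ (-‿inverseˡ _) ⟩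
    oneS n k + 0#                     ≈⟨ +-identityʳ _ ⟩
    oneS n k                          ≈⟨ oneS≋1 n k ⟩
    X.const (Y.const 1#) n k          ∎
    where open SetoidReasoning setoid

  -- The geometric series satisfies 1 + t + ... = 1 + t (1 + t + ...); here t is replaced by xy.
  inv1-xy-inverse : inv1-xy X.≋ X.const (Y.const 1#) X.⊕ X.X X.⊛ X.const Y.X X.⊛ inv1-xy
  inv1-xy-inverse n = begin
    inv1-xy n
      ≈⟨ inv≋ n ⟩
    X.compose ones xy n
      ≈⟨ X.compose-cong-≤ n xy (λ s _ → ones-unfold s) ⟩
    X.compose (X.const 1K X.⊕ X.X X.⊛ ones) xy n
      ≈⟨ X.compose-⊕ (X.const 1K) (X.X X.⊛ ones) xy n ⟩
    X.compose (X.const 1K) xy n Y.⊕ X.compose (X.X X.⊛ ones) xy n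
      ≈⟨ KR.+-cong {X.compose (X.const 1K) xy n} (X.compose-const 1K xy n) (X.compose-X⊛ (KR.zeroˡ Y.X) ones n) ⟩
    X.const 1K n Y.⊕ (xy X.⊛ X.compose ones xy) n
      ≈⟨ KR.+-congˡ {X.const 1K n} (X.⊛-cong {xy} (λ _ → KR.refl) inv≋ n) ⟨
    X.const 1K n Y.⊕ (xy X.⊛ inv1-xy) n ∎
    where
    module KR = CommutativeRing K
    open SetoidReasoning KR.setoid
    1K : Y.Series
    1K = Y.const 1#
    ones xy : X.Series
    ones _ = 1K
    xy = X.X X.⊛ X.const Y.X
    inv≋ : inv1-xy X.≋ X.compose ones xy
    inv≋ = substS≋compose (λ _ → 1#) (λ _ _ → refl) xyS≋Xy
    ones-unfold : ones X.≋ X.const 1K X.⊕ X.X X.⊛ ones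
    ones-unfold zero    k = sym (trans (+-congˡ (KR.zeroˡ 1K k)) (+-identityʳ _))
    ones-unfold (suc n) k = sym (trans (+-identityˡ _) (X.X-⊛-suc ones n k))

  module P = PyramidAscents K Y.X (Y.X Y.⊕ (λ k → - Y.const 1# k))
    (λ k → trans (+-congˡ (+-comm _ _)) (trans (sym (+-assoc _ _ _))
      (trans (+-congʳ (-‿inverseʳ _)) (+-identityˡ _))))

  open Exp (CommutativeRing.semiring K) using () renaming (_^_ to _^ʸ_)

  -- This Kronecker delta turns the marking by y to the power `pa` into the filter on `pa` in `G`.
  X^ : ∀ j k → (Y.X ^ʸ j) k ≈ (if j ≡ᵇ k then 1# else 0#)
  X^ zero    zero    = refl
  X^ zero    (suc k) = refl
  X^ (suc j) zero    = zeroˡ _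
  X^ (suc j) (suc k) = trans (Y.X-⊛-suc (Y.X ^ʸ j) k) (X^ j k)

  -- The paths of A_{m,d} as a weight.

  module _ (m d : ℕ) (z : ℤ → Carrier) where

    pathWeight : Word → Carrier
    pathWeight w = if inA m d w then weight z (+ m) w else 0#

    -- A peak has no flatstep and returns to its starting height, so all flatsteps keep their
    -- levels.
    weight-peak : ∀ h v w → weight z h (v ++ U ∷ D ∷ w) ≡ weight z h (v ++ w)
    weight-peak h []      w = ≡.cong (λ k → weight z k w) (up-down h)
    weight-peak h (U ∷ v) w = weight-peak (h ℤ.+ δ U) v w
    weight-peak h (D ∷ v) w = weight-peak (h ℤ.+ δ D) v w
    weight-peak h (F ∷ v) w = ≡.cong (z h *_) (weight-peak h v w)

    pathWeight-peak : ∀ v w → pathWeight (v ++ U ∷ D ∷ w) ≡ pathWeight (v ++ w)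
    pathWeight-peak v w = ≡.cong₂ (λ b x → if b then x else 0#) (inA-peak m d v w) (weight-peak (+ m) v w)

    pathWeight-support : ∀ w → 2 ℕ.* size w < length w → pathWeight w ≈ 0#
    pathWeight-support w long with endHeight (+ m) w ℤ.≟ + 0
    ... | yes end≡0 = contradiction (length≤2*size m w end≡0) (ℕₚ.<⇒≱ long)
    ... | no  _     = refl

    paths : WK.Weight
    paths = record
      { fn    = λ w → Y.const (pathWeight w)
      -- With this slack the cut-off of `gf paths` at n is 2n, the one in `pathsOfSize`.
      ; slack = 0
      ; supp  = λ w long → Y.const-0 (pathWeight-support w long)
      }

    paths-invariant : P.PeakInvariant paths
    paths-invariant v w = Y.const-cong (reflexive (pathWeight-peak v w))

    ∑-pathsOfSize : ∀ n f → ∑ (map f (pathsOfSize m d n)) ≈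
      WR.wordSum (2 ℕ.* n) (WR.atSize n (λ w → if inA m d w then f w else 0#))
    ∑-pathsOfSize n f = begin
      ∑ (map f (pathsOfSize m d n))
        ≈⟨ ∑-filterᵇ f _ (wordsUpTo (2 ℕ.* n)) ⟩
      ∑ (map (λ w → if inA m d w ∧ ⌊ size w ℕ.≟ n ⌋ then f w else 0#) (wordsUpTo (2 ℕ.* n)))
        ≈⟨ ∑-wordsUpTo (2 ℕ.* n) _ ⟩
      WR.wordSum (2 ℕ.* n) (λ w → if inA m d w ∧ ⌊ size w ℕ.≟ n ⌋ then f w else 0#)
        ≈⟨ WR.wordSum-cong (2 ℕ.* n) (λ w → nested w) ⟩
      WR.wordSum (2 ℕ.* n) (WR.atSize n (λ w → if inA m d w then f w else 0#)) ∎
      where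
      open SetoidReasoning setoid
      open ListSums R
      nested : ∀ w → (if inA m d w ∧ ⌊ size w ℕ.≟ n ⌋ then f w else 0#) ≈
                     WR.atSize n (λ w → if inA m d w then f w else 0#) w
      nested w rewrite ⌊≟⌋ (size w) n with inA m d w | size w ≡ᵇ n
      ... | true  | true  = refl
      ... | true  | false = refl
      ... | false | true  = refl
      ... | false | false = refl

    -- The values of `paths` are constant in y, and `Y.const` commutes with finite sums.
    gCoeff≋gf : ∀ s → Y.const (gCoeff m d z s) Y.≋ WK.gf paths s
    gCoeff≋gf s k = begin
      Y.const (gCoeff m d z s) k
        ≈⟨ Y.const-cong (∑-pathsOfSize s (weight z (+ m))) k ⟩
      Y.const (WR.wordSum (2 ℕ.* s) (WR.atSize s pathWeight)) k
        ≈⟨ const-wordSum (2 ℕ.* s) (WR.atSize s pathWeight) k ⟩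
      WR.wordSum (2 ℕ.* s) (λ w → Y.const (WR.atSize s pathWeight w) k)
        ≈⟨ WR.wordSum-cong (2 ℕ.* s) (λ w → const-atSize w k) ⟩
      WR.wordSum (2 ℕ.* s) (λ w → WK.atSize s (Y.const ∘ pathWeight) w k)
        ≡⟨ wordSum-coeff (2 ℕ.* s) (WK.atSize s (Y.const ∘ pathWeight)) k ⟨
      WK.gf paths s k ∎
      where
      open SetoidReasoning setoid
      const-wordSum : ∀ n f k → Y.const (WR.wordSum n f) k ≈ WR.wordSum n (λ w → Y.const (f w) k)
      const-wordSum n f zero    = refl
      const-wordSum n f (suc k) = sym (WR.wordSum-0 n λ _ → refl)
      const-atSize : ∀ w k → Y.const (WR.atSize s pathWeight w) k ≈ WK.atSize s (Y.const ∘ pathWeight) w k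
      const-atSize w k with size w ≡ᵇ s
      ... | true  = refl
      ... | false = Y.const-0 refl k

    -- Compared word by word: by `X^`, the coefficient of y^k in the marked weight of a word
    -- survives exactly when its `pa` is `k`.
    G≋A : G m d z X.≋ P.A paths
    G≋A n k = begin
      G m d z n k
        ≈⟨ ListSums.∑-filterᵇ R (weight z (+ m)) _ (pathsOfSize m d n) ⟩
      ∑ (map (λ w → if ⌊ pa w ℕ.≟ k ⌋ then weight z (+ m) w else 0#) (pathsOfSize m d n))
        ≈⟨ ∑-pathsOfSize n _ ⟩
      WR.wordSum (2 ℕ.* n) (WR.atSize n (λ w → if inA m d w then
        (if ⌊ pa w ℕ.≟ k ⌋ then weight z (+ m) w else 0#) else 0#))
        ≈⟨ WR.wordSum-cong (2 ℕ.* n) (λ w → coeff w) ⟩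
      WR.wordSum (2 ℕ.* n) (λ w → WK.atSize n (λ v → Y.const (pathWeight v) Y.⊛ P.pyramidal v) w k)
        ≡⟨ wordSum-coeff (2 ℕ.* n) (WK.atSize n (λ v → Y.const (pathWeight v) Y.⊛ P.pyramidal v)) k ⟨
      P.A paths n k ∎
      where
      open SetoidReasoning setoid
      selected : ∀ w → (if inA m d w then (if ⌊ pa w ℕ.≟ k ⌋ then weight z (+ m) w else 0#) else 0#) ≈
                       pathWeight w * (if pa w ≡ᵇ k then 1# else 0#)
      selected w rewrite ⌊≟⌋ (pa w) k with inA m d w | pa w ≡ᵇ k
      ... | true  | true  = sym (*-identityʳ _)
      ... | true  | false = sym (zeroʳ _)
      ... | false | true  = sym (zeroˡ _)
      ... | false | false = sym (zeroˡ _)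
      coeff : ∀ w → WR.atSize n (λ w → if inA m d w then
                      (if ⌊ pa w ℕ.≟ k ⌋ then weight z (+ m) w else 0#) else 0#) w ≈
                    WK.atSize n (λ v → Y.const (pathWeight v) Y.⊛ P.pyramidal v) w k
      coeff w with size w ≡ᵇ n
      ... | false = refl
      ... | true  = trans (selected w) (trans (*-congˡ (sym (X^ (pa w) k)))
                      (sym (Y.const-⊛ (pathWeight w) (P.pyramidal w) k)))

    LHS≋G : LHS m d z X.≋ G m d z
    LHS≋G n = begin
      LHS m d z n
        ≈⟨ *S≋⊛ ((oneS -S xS) *S inv1-xy) (substS (gCoeff m d z) h) n ⟩
      (((oneS -S xS) *S inv1-xy) X.⊛ substS (gCoeff m d z) h) n
        ≈⟨ X.⊛-cong (*S≋⊛ (oneS -S xS) inv1-xy) (substS≋compose (gCoeff m d z) gCoeff≋gf h≋) n ⟩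
      ((oneS -S xS) X.⊛ inv1-xy X.⊛ X.compose (WK.gf paths) (X.X X.⊛ (oneS -S xS) X.⊛ inv1-xy)) n
        ≈⟨ P.pyramidTransform p+X≋1 inv1-xy-inverse paths paths-invariant n ⟩
      P.A paths n
        ≈⟨ G≋A n ⟨
      G m d z n ∎
      where
      open SetoidReasoning (CommutativeRing.setoid K)
      h : PS
      h = (xS *S (oneS -S xS)) *S inv1-xy
      h≋ : h X.≋ X.X X.⊛ (oneS -S xS) X.⊛ inv1-xy
      h≋ n = CommutativeRing.trans K (*S≋⊛ (xS *S (oneS -S xS)) inv1-xy n)
        (X.⊛-cong (λ i → CommutativeRing.trans K (*S≋⊛ xS (oneS -S xS) i)
          (X.⊛-cong xS≋X (λ _ _ → refl) i)) (λ _ _ → refl) n)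

theorem18 : ∀ {c ℓ} (R : CommutativeRing c ℓ) (m d : ℕ) (z : ℤ → CommutativeRing.Carrier R) →
    ∀ n k → CommutativeRing._≈_ R (GF.LHS R m d z n k) (GF.G R m d z n k)
theorem18 = Bridge.LHS≋G
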